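{- Let $k \geq 3$ be an integer. For every $k$-regular graph $G$ (that is, every vertex of $G$ has degree exactly $k$), $V(G)$ can be partitioned into $k+1$ pairwise disjoint $k$-clique isolating sets of $G$.
   Context: All graphs are simple, finite and undirected. For $D \subseteq V(G)$, the closed neighborhood $N[D]$ is the set consisting of $D$ together with all vertices having a neighbor in $D$. A subset $D \subseteq V(G)$ is a $k$-clique isolating set of $G$ if $G - N[D]$ contains no complete graph $K_k$ as a subgraph. Partitions are weak, i.e. parts may be empty; equivalently, there is a map $c: V(G) \to \{1,\ldots,k+1\}$ (not required to be surjective) such that each of the $k+1$ color classes is a $k$-clique isolating set of $G$. -}

module Defs where

open import Data.Fin using (Fin; _≟_)
open import Data.Fin.Subset using (Subset; _∈_; _∩_; ∣_∣; Empty)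
open import Data.Nat using (ℕ)
open import Data.Product using (∃; _×_)
open import Data.Refinement using (Refinement-syntax; value)
open import Data.Sum using (_⊎_)
open import Data.Vec using (tabulate)
open import Function.Definitions using (Injective)
open import Level using (0ℓ)
open import Relation.Binary using (Rel; Decidable; Symmetric; Irreflexive)
open import Relation.Binary.PropositionalEquality using (_≡_; _≢_; refl; sym; cong)
open import Relation.Nullary using (¬_; does; ¬?)
open import Relation.Unary using (Pred)

-- Simple undirected graphs on V. Finite graphs are those with V = Fin n;
-- a general V is allowed so that vertex-deleted subgraphs are again graphs.
record Graph (V : Set) : Set₁ where
  field
    Adj        : Rel V 0ℓ
    adj?       : Decidable Adj
    adj-sym    : Symmetric Adj
    adj-irrefl : Irreflexive _≡_ Adj

open Graph public

K : (k : ℕ) → Graph (Fin k)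
K k .Adj i j             = i ≢ j
K k .adj? i j            = ¬? (i ≟ j)
K k .adj-sym i≢j j≡i     = i≢j (sym j≡i)
K k .adj-irrefl refl i≢i = i≢i refl

-- The induced subgraph G - S. Membership proofs in a refinement type are
-- irrelevant, so its vertices are exactly the vertices of G outside S.
infixl 6 _-_
_-_ : {V : Set} → Graph V → (S : Pred V 0ℓ) → Graph [ v ∈ V ∣ ¬ S v ]
(G - S) .Adj u v           = Adj G (value u) (value v)
(G - S) .adj? u v          = adj? G (value u) (value v)
(G - S) .adj-sym           = adj-sym G
(G - S) .adj-irrefl u≡v uv = adj-irrefl G (cong value u≡v) uv

-- G has a (not necessarily induced) subgraph isomorphic to H.
_ContainsCopyOf_ : {V W : Set} → Graph V → Graph W → Set
_ContainsCopyOf_ {V} {W} G H =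
  ∃ λ (f : W → V) →
    Injective _≡_ _≡_ f × (∀ {u v} → Adj H u v → Adj G (f u) (f v))

module _ {n : ℕ} where

  neighbours : Graph (Fin n) → Fin n → Subset n
  neighbours G v = tabulate λ u → does (adj? G v u)

  degree : Graph (Fin n) → Fin n → ℕ
  degree G v = ∣ neighbours G v ∣

  Regular : ℕ → Graph (Fin n) → Set
  Regular k G = ∀ v → degree G v ≡ k

  N[_] : Subset n → Graph (Fin n) → Pred (Fin n) 0ℓ
  N[ D ] G v = v ∈ D ⊎ ∃ λ u → u ∈ D × Adj G v u

  IsCliqueIsolating : ℕ → Graph (Fin n) → Subset n → Set
  IsCliqueIsolating k G D = ¬ ((G - N[ D ] G) ContainsCopyOf K k)

  -- Parts may be empty.
  IsPartition : {m : ℕ} → (Fin m → Subset n) → Set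
  IsPartition P =
    (∀ v → ∃ λ i → v ∈ P i) × (∀ {i j} → i ≢ j → Empty (P i ∩ P j))

{-# OPTIONS --safe #-}

-- A vertex v of a k-clique S has exactly one neighbour w outside S, so N[v] = S ∪ {w}.
-- It suffices to colour V(G) with k + 1 colours so that every k-clique
-- contains a vertex whose closed neighbourhood sees all colours (a "full" vertex).
-- Colour greedily, keeping every clique either uncoloured or with a full vertex.
-- If two different cliques S and T meet, in v say, they share k - 1 vertices, and making v
-- full makes all of S ∩ T full; as k ≥ 3, every other clique touching N[v] also meets S ∩ T.
-- A remaining clique S is disjoint from every other clique. If w is coloured, or lies in no
-- clique lacking a full vertex, make v full by completing the colouring of S ∪ {w}; otherwise
-- w lies in another untouched clique T, and both edge ends v and w are made full simultaneously.
module Submission where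

open import Defs hiding (_-_)
open import Data.Bool using (if_then_else_)
open import Data.Empty using (⊥-elim-irr)
open import Data.Fin using (Fin; zero; suc; _≟_)
open import Data.Fin.Properties using (all?; any?; suc-injective; ¬Fin0)
open import Data.Fin.Subset using (Subset; inside; outside; _∈_; _∉_; _⊆_; _∩_; _∪_; _─_; _-_; ⁅_⁆; ⊤; ∣_∣; Nonempty)
open import Data.Fin.Subset.Properties
open import Data.List using (List; []; _∷_; allFin)
import Data.List.Membership.Propositional as List
open import Data.List.Membership.Propositional.Properties using (∈-allFin)
open import Data.List.Relation.Unary.Any using (here; there)
open import Data.Maybe using (Maybe; just; nothing; _<∣>_; fromMaybe)
open import Data.Maybe.Properties using (≡-dec)
open import Data.Nat using (ℕ; zero; suc; _≤_; _<_; _≥_; z≤n; s≤s)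
open import Data.Nat.Properties using (≤-reflexive; ≤-trans; ≤-pred; <⇒≱; n≮n; module ≤-Reasoning)
import Data.Nat.Properties as ℕ
open import Data.Product using (∃; Σ; _×_; _,_; proj₁; proj₂)
open import Data.Refinement using (Refinement; _,_; value; value-injective)
open import Data.Irrelevant using ([_])
open import Data.Sum using (_⊎_; inj₁; inj₂)
open import Data.Unit using (tt) renaming (⊤ to Unit)
open import Data.Vec using ([]; _∷_; tabulate; here; there)
open import Data.Vec.Properties using ([]=⇒lookup; lookup⇒[]=; lookup∘tabulate)
open import Function using (_∘_)
open import Function.Definitions using (Injective)
open import Relation.Binary.PropositionalEquality
open import Relation.Nullary using (¬_; Dec; yes; no; does; ¬?; _×-dec_; _⊎-dec_; _→-dec_; contradiction)
open import Relation.Nullary.Decidable using (dec-true)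
open import Relation.Unary using (Decidable)

-- Subsets of `Fin n`: comprehension, cardinality and images.

module _ {n : ℕ} {P : Fin n → Set} (P? : Decidable P) where

  ∈-tabulate⁺ : ∀ {v} → P v → v ∈ tabulate (does ∘ P?)
  ∈-tabulate⁺ {v} Pv = lookup⇒[]= v _ (trans (lookup∘tabulate (does ∘ P?) v) (dec-true (P? v) Pv))

  ∈-tabulate⁻ : ∀ {v} → v ∈ tabulate (does ∘ P?) → P v
  ∈-tabulate⁻ {v} v∈ with P? v | trans (sym (lookup∘tabulate (does ∘ P?) v)) ([]=⇒lookup v∈)
  ... | yes Pv | _ = Pv

x∈p─q⇒x∉q : ∀ {n} (p q : Subset n) {x} → x ∈ p ─ q → x ∉ q
x∈p─q⇒x∉q (_ ∷ p) (outside ∷ q) (there x∈) (there x∈q) = x∈p─q⇒x∉q p q x∈ x∈q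
x∈p─q⇒x∉q (_ ∷ p) (inside ∷ q)  (there x∈) (there x∈q) = x∈p─q⇒x∉q p q x∈ x∈q

x∈p-y⇒x≢y : ∀ {n} (p : Subset n) {x} y → x ∈ p - y → x ≢ y
x∈p-y⇒x≢y p y x∈ refl = x∈p─q⇒x∉q p ⁅ y ⁆ x∈ (x∈⁅x⁆ y)

∣p∣≤1+∣p-x∣ : ∀ {n} (p : Subset n) x → ∣ p ∣ ≤ suc ∣ p - x ∣
∣p∣≤1+∣p-x∣ (outside ∷ p) zero    = ≤-trans (≤-reflexive (cong ∣_∣ (sym (p─⊥≡p p)))) (ℕ.n≤1+n _)
∣p∣≤1+∣p-x∣ (inside ∷ p)  zero    = s≤s (≤-reflexive (cong ∣_∣ (sym (p─⊥≡p p))))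
∣p∣≤1+∣p-x∣ (outside ∷ p) (suc x) = ∣p∣≤1+∣p-x∣ p x
∣p∣≤1+∣p-x∣ (inside ∷ p)  (suc x) = s≤s (∣p∣≤1+∣p-x∣ p x)

∣p∣≤2+∣p-x-y∣ : ∀ {n} (p : Subset n) x y → ∣ p ∣ ≤ suc (suc ∣ p - x - y ∣)
∣p∣≤2+∣p-x-y∣ p x y = ≤-trans (∣p∣≤1+∣p-x∣ p x) (s≤s (∣p∣≤1+∣p-x∣ (p - x) y))

2+∣p-x-y∣≤∣p∣ : ∀ {n} {p : Subset n} {x y} → x ∈ p → y ∈ p → x ≢ y → suc (suc ∣ p - x - y ∣) ≤ ∣ p ∣
2+∣p-x-y∣≤∣p∣ x∈p y∈p x≢y =
  ≤-trans (s≤s (x∈p⇒∣p-x∣<∣p∣ (x∈p∧x≢y⇒x∈p-y y∈p (x≢y ∘ sym)))) (x∈p⇒∣p-x∣<∣p∣ x∈p)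

∣p∣>0⇒Nonempty : ∀ {n} (p : Subset n) → 0 < ∣ p ∣ → Nonempty p
∣p∣>0⇒Nonempty {n} p 0<p with nonempty? p
... | yes ne = ne
... | no ¬ne = contradiction 0<p (<⇒≱ (s≤s (≤-reflexive (trans (cong ∣_∣ (Empty-unique ¬ne)) (∣⊥∣≡0 n)))))

∣⁅x⁆∪p∣≡1+∣p∣ : ∀ {n} {x : Fin n} (p : Subset n) → x ∉ p → ∣ ⁅ x ⁆ ∪ p ∣ ≡ suc ∣ p ∣
∣⁅x⁆∪p∣≡1+∣p∣ {x = zero}  (inside ∷ p)  x∉p = contradiction here x∉p
∣⁅x⁆∪p∣≡1+∣p∣ {x = zero}  (outside ∷ p) x∉p = cong (suc ∘ ∣_∣) (∪-identityˡ p)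
∣⁅x⁆∪p∣≡1+∣p∣ {x = suc x} (outside ∷ p) x∉p = ∣⁅x⁆∪p∣≡1+∣p∣ p (x∉p ∘ there)
∣⁅x⁆∪p∣≡1+∣p∣ {x = suc x} (inside ∷ p)  x∉p = cong suc (∣⁅x⁆∪p∣≡1+∣p∣ p (x∉p ∘ there))

image : ∀ {k n} → (Fin k → Fin n) → Subset n
image f = tabulate λ v → does (any? λ j → f j ≟ v)

∈-image⁺ : ∀ {k n} (f : Fin k → Fin n) j → f j ∈ image f
∈-image⁺ f j = ∈-tabulate⁺ (λ v → any? λ j → f j ≟ v) (j , refl)

∈-image⁻ : ∀ {k n} (f : Fin k → Fin n) {v} → v ∈ image f → ∃ λ j → f j ≡ v
∈-image⁻ f = ∈-tabulate⁻ λ v → any? λ j → f j ≟ v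

∣image∣ : ∀ {k n} (f : Fin k → Fin n) → Injective _≡_ _≡_ f → ∣ image f ∣ ≡ k
∣image∣ {zero} {n} f inj = trans (cong ∣_∣ (Empty-unique λ (_ , v∈) → ¬Fin0 (proj₁ (∈-image⁻ f v∈)))) (∣⊥∣≡0 n)
∣image∣ {suc k} f inj = begin
  ∣ image f ∣                              ≡⟨ cong ∣_∣ (⊆-antisym to from) ⟩
  ∣ ⁅ f zero ⁆ ∪ image (f ∘ suc) ∣         ≡⟨ ∣⁅x⁆∪p∣≡1+∣p∣ _ f0∉ ⟩
  suc ∣ image (f ∘ suc) ∣                  ≡⟨ cong suc (∣image∣ (f ∘ suc) (suc-injective ∘ inj)) ⟩
  suc k                                    ∎
  where
  open ≡-Reasoning
  f0∉ : f zero ∉ image (f ∘ suc)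
  f0∉ f0∈ with ∈-image⁻ (f ∘ suc) f0∈
  ... | j , eq with inj eq
  ... | ()
  to : image f ⊆ ⁅ f zero ⁆ ∪ image (f ∘ suc)
  to v∈ with ∈-image⁻ f v∈
  ... | zero  , refl = x∈p∪q⁺ (inj₁ (x∈⁅x⁆ _))
  ... | suc j , refl = x∈p∪q⁺ (inj₂ (∈-image⁺ (f ∘ suc) j))
  from : ⁅ f zero ⁆ ∪ image (f ∘ suc) ⊆ image f
  from v∈ with x∈p∪q⁻ ⁅ f zero ⁆ _ v∈
  ... | inj₁ v∈₀ with refl ← x∈⁅y⁆⇒x≡y _ v∈₀ = ∈-image⁺ f zero
  ... | inj₂ v∈₁ with j , refl ← ∈-image⁻ (f ∘ suc) v∈₁ = ∈-image⁺ f (suc j)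

-- Each member of `R` in turn takes one element still left in `F`, until `F` is exhausted. This will
-- spread the missing colours over the free vertices of a clique; `i₀` is a default for all other
-- arguments.
surjection : ∀ {n m} (R : Subset n) (F : Subset m) → Fin m → ∣ F ∣ ≤ ∣ R ∣ →
             ∃ λ (g : Fin n → Fin m) → ∀ {i} → i ∈ F → ∃ λ u → u ∈ R × g u ≡ i
surjection R F i₀ F≤R with nonempty? F
surjection R F i₀ F≤R | no ¬ne = (λ _ → i₀) , λ i∈F → contradiction (_ , i∈F) ¬ne
surjection [] F i₀ F≤R | yes (_ , i∈F) = contradiction (≤-trans (x∈p⇒∣p-x∣<∣p∣ i∈F) F≤R) λ ()
surjection (outside ∷ R) F i₀ F≤R | yes _ with surjection R F i₀ F≤R
... | g , onto = g⁺ , λ i∈F → let u , u∈R , eq = onto i∈F in suc u , there u∈R , eq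
  where
  g⁺ : Fin _ → Fin _
  g⁺ zero    = i₀
  g⁺ (suc u) = g u
surjection (inside ∷ R) F i₀ F≤R | yes (j , j∈F)
  with surjection R (F - j) i₀ (≤-pred (≤-trans (x∈p⇒∣p-x∣<∣p∣ j∈F) F≤R))
... | g , onto = g⁺ , onto⁺
  where
  g⁺ : Fin _ → Fin _
  g⁺ zero    = j
  g⁺ (suc u) = g u
  onto⁺ : ∀ {i} → i ∈ F → ∃ λ u → u ∈ inside ∷ R × g⁺ u ≡ i
  onto⁺ {i} i∈F with i ≟ j
  ... | yes refl = zero , here , refl
  ... | no i≢j with onto (x∈p∧x≢y⇒x∈p-y i∈F i≢j)
  ... | u , u∈R , eq = suc u , there u∈R , eq

different-element : ∀ {m} → 2 ≤ m → (b : Fin m) → ∃ λ a → a ≢ b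
different-element (s≤s (s≤s _)) zero    = suc zero , λ ()
different-element (s≤s (s≤s _)) (suc _) = zero , λ ()

-- Partial colourings

module _ {n m : ℕ} where

  Colouring : Set
  Colouring = Fin n → Maybe (Fin m)

  Coloured : Colouring → Fin n → Set
  Coloured c v = ∃ λ i → c v ≡ just i

  infix 4 _≼_
  _≼_ : Colouring → Colouring → Set
  c ≼ c′ = ∀ {v i} → c v ≡ just i → c′ v ≡ just i

  coloured? : ∀ c v → Coloured c v ⊎ c v ≡ nothing
  coloured? c v with c v
  ... | just i  = inj₁ (i , refl)
  ... | nothing = inj₂ refl

  uncoloured : ∀ (c : Colouring) {v} → ¬ Coloured c v → c v ≡ nothing
  uncoloured c {v} ¬cv with coloured? c v
  ... | inj₁ cv = contradiction cv ¬cv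
  ... | inj₂ cv = cv

  nothing⇒¬Coloured : ∀ (c : Colouring) {v} → c v ≡ nothing → ¬ Coloured c v
  nothing⇒¬Coloured c eq (_ , eq′) with trans (sym eq) eq′
  ... | ()

  -- `New` bounds the freshly coloured vertices, so that the invariant has to be rechecked only for
  -- cliques meeting `New`.
  record Extension (c : Colouring) (New : Fin n → Set) : Set where
    constructor extension
    field
      colouring : Colouring
      extends   : c ≼ colouring
      new       : ∀ {v} → Coloured colouring v → New v ⊎ Coloured c v

  open Extension public

  unchanged : ∀ {c New} (e : Extension c New) {v} → ¬ New v → c v ≡ nothing → colouring e v ≡ nothing
  unchanged {c} e ¬new cv = uncoloured (colouring e) λ cv′ → absurd (new e cv′)
    where
    absurd : ¬ (_ ⊎ Coloured c _)
    absurd (inj₁ new) = ¬new new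
    absurd (inj₂ cv′) = nothing⇒¬Coloured c cv cv′

  extend-on : (c : Colouring) (R : Subset n) (g : Fin n → Fin m) → (∀ {v} → v ∈ R → c v ≡ nothing) →
              Σ (Extension c (_∈ R)) λ e → ∀ {v} → v ∈ R → colouring e v ≡ just (g v)
  extend-on c R g unc = extension c′ ext new′ , val
    where
    c′ : Colouring
    -- The left bias of `<∣>` protects colours already given.
    c′ v = c v <∣> (if does (v ∈? R) then just (g v) else nothing)
    ext : c ≼ c′
    ext eq rewrite eq = refl
    new′ : ∀ {v} → Coloured c′ v → v ∈ R ⊎ Coloured c v
    new′ {v} (i , eq) with c v | v ∈? R
    ... | just j  | _ = inj₂ (j , refl)
    ... | nothing | yes v∈R = inj₁ v∈R
    val : ∀ {v} → v ∈ R → c′ v ≡ just (g v)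
    val {v} v∈R rewrite unc v∈R | dec-true (v ∈? R) v∈R = refl

  paint : (c : Colouring) (v : Fin n) (i : Fin m) → c v ≡ nothing →
          Σ (Extension c (_≡ v)) λ e → colouring e v ≡ just i
  paint c v i unc with extend-on c ⁅ v ⁆ (λ _ → i) unc′
    where
    unc′ : ∀ {u} → u ∈ ⁅ v ⁆ → c u ≡ nothing
    unc′ u∈ = trans (cong c (x∈⁅y⁆⇒x≡y v u∈)) unc
  ... | e , val = extension (colouring e) (extends e) new′ , val (x∈⁅x⁆ v)
    where
    new′ : ∀ {u} → Coloured (colouring e) u → u ≡ v ⊎ Coloured c u
    new′ cu with new e cu
    ... | inj₁ u∈ = inj₁ (x∈⁅y⁆⇒x≡y v u∈)
    ... | inj₂ cu = inj₂ cu

-- Cliques in a regular graph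

module _ {k n : ℕ} (k≥3 : k ≥ 3) (G : Graph (Fin n)) (regular : Regular k G) where

  Partial : Set
  Partial = Colouring {n} {suc k}

  -- Cliques are vertex sets rather than embeddings of `K k`, so that a search through all of them
  -- is decidable by `anySubset?`.
  IsClique : Subset n → Set
  IsClique S = ∣ S ∣ ≡ k × (∀ u → u ∈ S → ∀ v → v ∈ S → u ≢ v → Adj G u v)

  isClique? : Decidable IsClique
  isClique? S = (∣ S ∣ ℕ.≟ k) ×-dec
    all? λ u → (u ∈? S) →-dec all? λ v → (v ∈? S) →-dec (¬? (u ≟ v) →-dec adj? G u v)

  clique-nonempty : ∀ {S} → IsClique S → Nonempty S
  clique-nonempty {S} (∣S∣≡k , _) =
    ∣p∣>0⇒Nonempty S (≤-trans (s≤s z≤n) (≤-trans k≥3 (≤-reflexive (sym ∣S∣≡k))))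

  Meets : Subset n → Subset n → Set
  Meets S T = ∃ λ v → v ∈ S × v ∈ T

  -- For a clique `S`, by equal cardinalities, this says that `S` meets a clique other than itself;
  -- the point `x` is the form in which the difference gets used.
  Crossing : Subset n → Set
  Crossing S = ∃ λ T → IsClique T × Meets S T × ∃ λ x → x ∈ S × x ∉ T

  crossing? : Decidable Crossing
  crossing? S = anySubset? λ T → isClique? T ×-dec
    (any? λ v → (v ∈? S) ×-dec (v ∈? T)) ×-dec any? λ x → (x ∈? S) ×-dec ¬? (x ∈? T)

  ¬crossing⇒⊆ : ∀ {S T} → ¬ Crossing S → IsClique T → Meets S T → S ⊆ T
  ¬crossing⇒⊆ {S} {T} ¬cr clT meets {x} x∈S with x ∈? T
  ... | yes x∈T = x∈T
  ... | no  x∉T = contradiction (T , clT , meets , x , x∈S , x∉T) ¬cr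

  ∈-neighbours⁺ : ∀ {v u} → Adj G v u → u ∈ neighbours G v
  ∈-neighbours⁺ {v} = ∈-tabulate⁺ (adj? G v)

  ∈-neighbours⁻ : ∀ {v u} → u ∈ neighbours G v → Adj G v u
  ∈-neighbours⁻ {v} = ∈-tabulate⁻ (adj? G v)

  adj⇒≢ : ∀ {u v} → Adj G u v → u ≢ v
  adj⇒≢ uv u≡v = adj-irrefl G u≡v uv

  -- Of the `k` neighbours of `v`, exactly `k - 1` are the other vertices of `S`, which leaves one.
  outside-neighbour : ∀ {S v} → IsClique S → v ∈ S →
    ∃ λ w → w ∉ S × Adj G v w × (∀ {u} → Adj G v u → u ∈ S ⊎ u ≡ w)
  outside-neighbour {S} {v} (∣S∣≡k , adj) v∈S = w , w∉S , ∈-neighbours⁻ w∈nb , unique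
    where
    nb : Subset n
    nb = neighbours G v
    S-v⊆nb : S - v ⊆ nb
    S-v⊆nb {u} u∈ = ∈-neighbours⁺ (adj v v∈S u (p─q⊆p S ⁅ v ⁆ u∈) (x∈p-y⇒x≢y S v u∈ ∘ sym))
    exists : Nonempty (nb ─ S)
    exists with nonempty? (nb ─ S)
    ... | yes ne = ne
    ... | no ¬ne = contradiction (p⊆q⇒∣p∣≤∣q∣ nb⊆S-v)
      (<⇒≱ (≤-trans (x∈p⇒∣p-x∣<∣p∣ v∈S) (≤-reflexive (trans ∣S∣≡k (sym (regular v))))))
      where
      nb⊆S-v : nb ⊆ S - v
      nb⊆S-v {u} u∈ with u ∈? S
      ... | yes u∈S = x∈p∧x≢y⇒x∈p-y u∈S (adj⇒≢ (∈-neighbours⁻ u∈) ∘ sym)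
      ... | no  u∉S = contradiction (u , x∈p∧x∉q⇒x∈p─q u∈ u∉S) ¬ne
    w : Fin n
    w = proj₁ exists
    w∈nb : w ∈ nb
    w∈nb = p─q⊆p nb S (proj₂ exists)
    w∉S : w ∉ S
    w∉S = x∈p─q⇒x∉q nb S (proj₂ exists)
    unique : ∀ {u} → Adj G v u → u ∈ S ⊎ u ≡ w
    unique {u} vu with u ∈? S | u ≟ w
    ... | yes u∈S | _       = inj₁ u∈S
    ... | no  _   | yes u≡w = inj₂ u≡w
    -- Otherwise `S - v` would fit into the neighbours of `v` with two of them removed, giving
    -- `k - 1 ≤ k - 2`.
    ... | no  u∉S | no  u≢w = contradiction too-small (n≮n k)
      where
      S-v⊆ : S - v ⊆ nb - w - u
      S-v⊆ x∈ = x∈p∧x≢y⇒x∈p-y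
        (x∈p∧x≢y⇒x∈p-y (S-v⊆nb x∈) λ { refl → w∉S (p─q⊆p S ⁅ v ⁆ x∈) })
        λ { refl → u∉S (p─q⊆p S ⁅ v ⁆ x∈) }
      too-small : k < k
      too-small = begin-strict
        k                      ≡⟨ ∣S∣≡k ⟨
        ∣ S ∣                  ≤⟨ ∣p∣≤1+∣p-x∣ S v ⟩
        suc ∣ S - v ∣          ≤⟨ s≤s (p⊆q⇒∣p∣≤∣q∣ S-v⊆) ⟩
        suc ∣ nb - w - u ∣     <⟨ 2+∣p-x-y∣≤∣p∣ w∈nb (∈-neighbours⁺ vu) (u≢w ∘ sym) ⟩
        ∣ nb ∣                 ≡⟨ regular v ⟩
        k                      ∎
        where open ≤-Reasoning

  -- In `U`, the vertex `z` has `k - 1 ≥ 2` neighbours, and at most one of them, `w`, lies outside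
  -- `S`. Here `k ≥ 3` is used at full strength.
  second-common : ∀ {S U z} → IsClique S → IsClique U → z ∈ S → z ∈ U →
                  ∃ λ z′ → z′ ∈ S × z′ ∈ U × z′ ≢ z
  second-common {S} {U} {z} clS (∣U∣≡k , adjU) z∈S z∈U
    with w , _ , _ , unique ← outside-neighbour clS z∈S
    with z′ , z′∈ ← ∣p∣>0⇒Nonempty (U - z - w) (≤-pred (≤-pred
           (≤-trans k≥3 (≤-trans (≤-reflexive (sym ∣U∣≡k)) (∣p∣≤2+∣p-x-y∣ U z w)))))
    = z′ , in-S , z′∈U , z′≢z
    where
    z′∈U-z : z′ ∈ U - z
    z′∈U-z = p─q⊆p (U - z) ⁅ w ⁆ z′∈
    z′∈U : z′ ∈ U
    z′∈U = p─q⊆p U ⁅ z ⁆ z′∈U-z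
    z′≢z : z′ ≢ z
    z′≢z = x∈p-y⇒x≢y U z z′∈U-z
    in-S : z′ ∈ S
    in-S with unique (adjU z z∈U z′ z′∈U (z′≢z ∘ sym))
    ... | inj₁ z′∈S = z′∈S
    ... | inj₂ z′≡w = contradiction z′≡w (x∈p-y⇒x≢y (U - z) w z′∈)

  -- Full vertices and the completion of a clique.

  Full : Partial → Fin n → Set
  Full c v = ∀ i → ∃ λ u → (v ≡ u ⊎ Adj G v u) × c u ≡ just i

  HasFull : Partial → Subset n → Set
  HasFull c S = ∃ λ v → v ∈ S × Full c v

  -- Contrapositively, a clique without a full vertex is wholly uncoloured, hence still free to be
  -- completed around any of its vertices.
  Invariant : Partial → Set
  Invariant c = ∀ {S v} → IsClique S → v ∈ S → Coloured c v → HasFull c S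

  full? : ∀ c → Decidable (Full c)
  full? c v = all? λ i → any? λ u → ((v ≟ u) ⊎-dec adj? G v u) ×-dec ≡-dec _≟_ (c u) (just i)

  hasFull? : ∀ c → Decidable (HasFull c)
  hasFull? c S = any? λ v → (v ∈? S) ×-dec full? c v

  Full-mono : ∀ {c c′ v} → c ≼ c′ → Full c v → Full c′ v
  Full-mono c≼c′ full i = let u , near , eq = full i in u , near , c≼c′ eq

  HasFull-mono : ∀ {c c′ S} → c ≼ c′ → HasFull c S → HasFull c′ S
  HasFull-mono c≼c′ (v , v∈S , full) = v , v∈S , Full-mono c≼c′ full

  ¬hasFull⇒uncoloured : ∀ {c S v} → Invariant c → IsClique S → ¬ HasFull c S → v ∈ S → c v ≡ nothing
  ¬hasFull⇒uncoloured {c} inv clS ¬full v∈S = uncoloured c λ cv → ¬full (inv clS v∈S cv)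

  -- With `a` on `v` and `b` on `w`, the remaining `k - 1` colours go onto the `k - 1` vertices of
  -- `S - v`, all adjacent to `v`. Taking `v` as already coloured allows a second use with the ends
  -- of the edge exchanged.
  fill : ∀ c {S v w a b} → IsClique S → v ∈ S → Adj G v w → c v ≡ just a → c w ≡ just b → a ≢ b →
         (∀ {u} → u ∈ S → u ≢ v → c u ≡ nothing) →
         Σ (Extension c (_∈ S)) λ e → Full (colouring e) v × (∀ {u} → u ∈ S → Coloured (colouring e) u)
  fill c {S} {v} {w} {a} {b} (∣S∣≡k , adj) v∈S vw cv cw a≢b unc
    with g , onto ← surjection (S - v) (⊤ - a - b) a (≤-pred (≤-pred (≤-trans (2+∣p-x-y∣≤∣p∣ ∈⊤ ∈⊤ a≢b)
           (≤-trans (≤-reflexive (trans (∣⊤∣≡n (suc k)) (cong suc (sym ∣S∣≡k)))) (s≤s (∣p∣≤1+∣p-x∣ S v))))))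
    with e , val ← extend-on c (S - v) g (λ u∈ → unc (p─q⊆p S ⁅ v ⁆ u∈) (x∈p-y⇒x≢y S v u∈))
    = extension (colouring e) (extends e) new′ , full , all-coloured
    where
    new′ : ∀ {u} → Coloured (colouring e) u → u ∈ S ⊎ Coloured c u
    new′ cu with new e cu
    ... | inj₁ u∈ = inj₁ (p─q⊆p S ⁅ v ⁆ u∈)
    ... | inj₂ cu = inj₂ cu
    full : Full (colouring e) v
    full i with i ≟ a | i ≟ b
    ... | yes refl | _ = v , inj₁ refl , extends e cv
    ... | no _ | yes refl = w , inj₂ vw , extends e cw
    ... | no i≢a | no i≢b with onto (x∈p∧x≢y⇒x∈p-y (x∈p∧x≢y⇒x∈p-y ∈⊤ i≢a) i≢b)
    ... | u , u∈ , refl =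
      u , inj₂ (adj v v∈S u (p─q⊆p S ⁅ v ⁆ u∈) (x∈p-y⇒x≢y S v u∈ ∘ sym)) , val u∈
    all-coloured : ∀ {u} → u ∈ S → Coloured (colouring e) u
    all-coloured {u} u∈S with u ≟ v
    ... | yes refl = a , extends e cv
    ... | no  u≢v  = _ , val (x∈p∧x≢y⇒x∈p-y u∈S u≢v)

  -- The distinct colours of `v` and `w` are kept so that `fill` can be applied next from the `w`
  -- end of the edge.
  record Completed (c : Partial) (S : Subset n) (v w : Fin n) (New : Fin n → Set) : Set where
    constructor completed
    field
      ext          : Extension c New
      full         : Full (colouring ext) v
      all-coloured : ∀ {u} → u ∈ S → Coloured (colouring ext) u
      {a b}        : Fin (suc k)
      a≢b          : a ≢ b
      v-colour     : colouring ext v ≡ just a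
      w-colour     : colouring ext w ≡ just b

  complete : ∀ c {S v w} → IsClique S → v ∈ S → Adj G v w → (∀ {u} → u ∈ S → c u ≡ nothing) →
             Coloured c w → Completed c S v w (_∈ S)
  complete c {S} {v} {w} clS v∈S vw unc (b , cw)
    with a , a≢b ← different-element (s≤s (≤-trans (s≤s z≤n) k≥3)) b
    with e₁ , cv ← paint c v a (unc v∈S)
    with e₂ , full , cS ← fill (colouring e₁) clS v∈S vw cv (extends e₁ cw) a≢b
           (λ u∈S u≢v → unchanged e₁ u≢v (unc u∈S))
    = completed (extension (colouring e₂) (extends e₂ ∘ extends e₁) new′) full cS a≢b
        (extends e₂ cv) (extends e₂ (extends e₁ cw))
    where
    new′ : ∀ {u} → Coloured (colouring e₂) u → u ∈ S ⊎ Coloured c u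
    new′ cu with new e₂ cu
    ... | inj₁ u∈S = inj₁ u∈S
    ... | inj₂ cu with new e₁ cu
    ... | inj₁ refl = inj₁ v∈S
    ... | inj₂ cu   = inj₂ cu

  -- An uncoloured `w` first gets the arbitrary colour `zero`, which is why `w` joins `S` among the
  -- possibly new vertices. As `w ∉ S`, this leaves `S` blank.
  complete′ : ∀ c {S v w} → IsClique S → v ∈ S → w ∉ S → Adj G v w → (∀ {u} → u ∈ S → c u ≡ nothing) →
              Completed c S v w (λ u → u ∈ S ⊎ u ≡ w)
  complete′ c {S} {v} {w} clS v∈S w∉S vw unc with coloured? c w
  ... | inj₁ cw with completed e full cS a≢b cv cw′ ← complete c clS v∈S vw unc cw =
    completed (extension (colouring e) (extends e) new′) full cS a≢b cv cw′
    where
    new′ : ∀ {u} → Coloured (colouring e) u → (u ∈ S ⊎ u ≡ w) ⊎ Coloured c u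
    new′ cu with new e cu
    ... | inj₁ u∈S = inj₁ (inj₁ u∈S)
    ... | inj₂ cu  = inj₂ cu
  ... | inj₂ cw
    with e₁ , cw₁ ← paint c w zero cw
    with completed e₂ full cS a≢b cv cw₂ ← complete (colouring e₁) clS v∈S vw
           (λ u∈S → unchanged e₁ (λ { refl → w∉S u∈S }) (unc u∈S)) (_ , cw₁)
    = completed (extension (colouring e₂) (extends e₂ ∘ extends e₁) new′) full cS a≢b cv cw₂
    where
    new′ : ∀ {u} → Coloured (colouring e₂) u → (u ∈ S ⊎ u ≡ w) ⊎ Coloured c u
    new′ cu with new e₂ cu
    ... | inj₁ u∈S = inj₁ (inj₁ u∈S)
    ... | inj₂ cu with new e₁ cu
    ... | inj₁ u≡w = inj₁ (inj₂ u≡w)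
    ... | inj₂ cu  = inj₂ cu

  -- Greedy steps

  -- Asking for all of `S` to be coloured gives, through the invariant, a full vertex in every
  -- clique that meets `S`, not only in `S`.
  Step : Partial → Subset n → Set
  Step c S = ∃ λ c′ → c ≼ c′ × Invariant c′ × (∀ {v} → v ∈ S → Coloured c′ v)

  -- For `v` in `S ∩ T`, `N[v] = S ∪ {w} = T ∪ {x}`. So each `z` in `S ∩ T` is adjacent to all the
  -- rest of `S ∪ {w}` and is full once `v` is; new colours occur only in `S ∪ {w}`.
  crossing-step : ∀ {c S} → Invariant c → IsClique S → Crossing S → ¬ HasFull c S → Step c S
  crossing-step {c} {S} inv clS (T , clT , (v , v∈S , v∈T) , x , x∈S , x∉T) ¬full
    with w , w∉S , vw , N⊆S+w ← outside-neighbour clS v∈S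
    with y , _ , _ , N⊆T+y ← outside-neighbour clT v∈T
    with completed e full cS _ _ _ ← complete′ c clS v∈S w∉S vw (¬hasFull⇒uncoloured inv clS ¬full)
    = colouring e , extends e , inv′ , cS
    where
    N⊆T+x : ∀ {u} → Adj G v u → u ∈ T ⊎ u ≡ x
    N⊆T+x vu with N⊆T+y vu
    ... | inj₁ u∈T  = inj₁ u∈T
    -- The unique neighbour `y` of `v` outside `T` must be `x`, which is adjacent to `v` through
    -- `S`.
    ... | inj₂ refl with N⊆T+y (proj₂ clS v v∈S x x∈S λ { refl → x∉T v∈T })
    ... | inj₁ x∈T = contradiction x∈T x∉T
    ... | inj₂ x≡y = inj₂ (sym x≡y)

    w∈T : w ∈ T
    w∈T with N⊆T+x vw
    ... | inj₁ w∈T  = w∈T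
    ... | inj₂ refl = contradiction x∈S w∉S

    S⊆T+x : ∀ {u} → u ∈ S → u ∈ T ⊎ u ≡ x
    S⊆T+x {u} u∈S with v ≟ u
    ... | yes refl = inj₁ v∈T
    ... | no  v≢u  = N⊆T+x (proj₂ clS v v∈S u u∈S v≢u)

    T⊆S+w : ∀ {u} → u ∈ T → u ∈ S ⊎ u ≡ w
    T⊆S+w {u} u∈T with v ≟ u
    ... | yes refl = inj₁ v∈S
    ... | no  v≢u  = N⊆S+w (proj₂ clT v v∈T u u∈T v≢u)

    full-∩ : ∀ {z} → z ∈ S → z ∈ T → Full (colouring e) z
    full-∩ {z} z∈S z∈T i with full i
    ... | u , near , cu = u , near-z , cu
      where
      in-S+w : (v ≡ u ⊎ Adj G v u) → u ∈ S ⊎ u ≡ w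
      in-S+w (inj₁ refl) = inj₁ v∈S
      in-S+w (inj₂ vu)   = N⊆S+w vu
      near-z : z ≡ u ⊎ Adj G z u
      near-z with z ≟ u | in-S+w near
      ... | yes z≡u | _         = inj₁ z≡u
      ... | no  z≢u | inj₁ u∈S  = inj₂ (proj₂ clS z z∈S u u∈S z≢u)
      ... | no  z≢u | inj₂ refl = inj₂ (proj₂ clT z z∈T w w∈T z≢u)

    meets-S : ∀ {U u} → IsClique U → u ∈ U → u ∈ S → HasFull (colouring e) U
    meets-S clU u∈U u∈S with S⊆T+x u∈S
    ... | inj₁ u∈T = _ , u∈U , full-∩ u∈S u∈T
    -- `x` is the only vertex of `S` outside `T`, so a second common vertex of `S` and `U` lies in
    -- `S ∩ T`.
    ... | inj₂ refl with z , z∈S , z∈U , z≢x ← second-common clS clU x∈S u∈U with S⊆T+x z∈S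
    ... | inj₁ z∈T = z , z∈U , full-∩ z∈S z∈T
    ... | inj₂ z≡x = contradiction z≡x z≢x

    meets-T : ∀ {U u} → IsClique U → u ∈ U → u ∈ T → HasFull (colouring e) U
    meets-T clU u∈U u∈T with T⊆S+w u∈T
    ... | inj₁ u∈S = _ , u∈U , full-∩ u∈S u∈T
    ... | inj₂ refl with z , z∈T , z∈U , z≢w ← second-common clT clU w∈T u∈U with T⊆S+w z∈T
    ... | inj₁ z∈S = z , z∈U , full-∩ z∈S z∈T
    ... | inj₂ z≡w = contradiction z≡w z≢w

    inv′ : Invariant (colouring e)
    inv′ clU u∈U cu with new e cu
    ... | inj₁ (inj₁ u∈S)  = meets-S clU u∈U u∈S
    ... | inj₁ (inj₂ refl) = meets-T clU u∈U w∈T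
    ... | inj₂ cu          = HasFull-mono (extends e) (inv clU u∈U cu)

  CrossingFull : Partial → Set
  CrossingFull c = ∀ {S} → IsClique S → Crossing S → HasFull c S

  -- Without a full vertex `S` cannot be crossing, so a clique meeting `S` contains all of it, in
  -- particular the vertex about to be made full.
  absorbs : ∀ {c S U u} → CrossingFull c → IsClique S → ¬ HasFull c S →
            IsClique U → u ∈ U → u ∈ S → S ⊆ U
  absorbs cf clS ¬full clU u∈U u∈S = ¬crossing⇒⊆ (¬full ∘ cf clS) clU (_ , u∈S , u∈U)

  noncrossing-step : ∀ {c S} → CrossingFull c → Invariant c → IsClique S → ¬ HasFull c S → Step c S
  noncrossing-step {c} {S} cf inv clS ¬full
    with v , v∈S ← clique-nonempty clS
    with w , w∉S , vw , _ ← outside-neighbour clS v∈S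
    = by-cases (coloured? c w)
        (anySubset? λ T → isClique? T ×-dec (w ∈? T) ×-dec ¬? (hasFull? c T))
    where
    ⊇S : ∀ {U u} → IsClique U → u ∈ U → u ∈ S → S ⊆ U
    ⊇S = absorbs cf clS ¬full

    uncS : ∀ {u} → u ∈ S → c u ≡ nothing
    uncS = ¬hasFull⇒uncoloured inv clS ¬full

    by-cases : Coloured c w ⊎ c w ≡ nothing →
               Dec (∃ λ T → IsClique T × w ∈ T × ¬ HasFull c T) → Step c S
    by-cases (inj₁ cw) _
      with completed e full cS _ _ _ ← complete c clS v∈S vw uncS cw
      = colouring e , extends e , inv′ , cS
      where
      inv′ : Invariant (colouring e)
      inv′ clU u∈U cu with new e cu
      ... | inj₁ u∈S = v , ⊇S clU u∈U u∈S v∈S , full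
      ... | inj₂ cu  = HasFull-mono (extends e) (inv clU u∈U cu)
    by-cases (inj₂ _) (no ¬T)
      with completed e full cS _ _ _ ← complete′ c clS v∈S w∉S vw uncS
      = colouring e , extends e , inv′ , cS
      where
      inv′ : Invariant (colouring e)
      inv′ {U} clU u∈U cu with new e cu
      ... | inj₁ (inj₁ u∈S)  = v , ⊇S clU u∈U u∈S v∈S , full
      ... | inj₂ cu          = HasFull-mono (extends e) (inv clU u∈U cu)
      -- Outside `S` only `w` can be new, and by the failed search every clique through `w` already
      -- has a full vertex.
      ... | inj₁ (inj₂ refl) with hasFull? c U
      ...   | yes fullU = HasFull-mono (extends e) fullU
      ...   | no ¬fullU = contradiction (U , clU , u∈U , ¬fullU) ¬T
    by-cases (inj₂ cw) (yes (T , clT , w∈T , ¬fullT))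
      -- After `w` is painted, `S` is completed around `v`, then `T` around `w`, with `v` as the
      -- coloured neighbour of `w` outside `T`.
      with e₁ , cw₁ ← paint c w zero cw
      with completed e₂ full-v cS a≢b cv₂ cw₂ ← complete (colouring e₁) clS v∈S vw
             (λ u∈S → unchanged e₁ (λ { refl → w∉S u∈S }) (uncS u∈S)) (_ , cw₁)
      -- A common vertex of `S` and `T` would force `T ⊆ S`, hence `w ∈ S`. So completing `S` has
      -- left `T` blank except at `w`.
      with e₃ , full-w , _ ← fill (colouring e₂) clT w∈T (adj-sym G vw) cw₂ cv₂ (a≢b ∘ sym)
             (λ u∈T u≢w → unchanged e₂ (λ u∈S → w∉S (absorbs cf clT ¬fullT clS u∈S u∈T w∈T))
               (unchanged e₁ u≢w (¬hasFull⇒uncoloured inv clT ¬fullT u∈T)))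
      = colouring e₃ , extends e₃ ∘ extends e₂ ∘ extends e₁ , inv′ ,
        λ u∈S → let i , cu = cS u∈S in i , extends e₃ cu
      where
      ⊇T : ∀ {U u} → IsClique U → u ∈ U → u ∈ T → T ⊆ U
      ⊇T = absorbs cf clT ¬fullT
      inv′ : Invariant (colouring e₃)
      inv′ clU u∈U cu with new e₃ cu
      ... | inj₁ u∈T = w , ⊇T clU u∈U u∈T w∈T , full-w
      ... | inj₂ cu with new e₂ cu
      ... | inj₁ u∈S = v , ⊇S clU u∈U u∈S v∈S , Full-mono (extends e₃) full-v
      ... | inj₂ cu with new e₁ cu
      ... | inj₁ refl = w , u∈U , full-w
      ... | inj₂ cu = HasFull-mono (extends e₃ ∘ extends e₂ ∘ extends e₁) (inv clU u∈U cu)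

  -- Sweeping through all vertices.

  module _ {Target : Subset n → Set} (target? : Decidable Target) {c₀ : Partial}
           (step : ∀ {c S} → c₀ ≼ c → Invariant c → IsClique S → Target S → ¬ HasFull c S → Step c S) where

    -- One step per vertex suffices: it colours `v`, and the invariant then provides a full vertex
    -- in every clique through `v`. Recursion thus runs over vertices, not cliques; `c₀ ≼ c` carries
    -- facts about `c₀` to the current colouring.
    sweep : ∀ (vs : List (Fin n)) {c} → c₀ ≼ c → Invariant c →
            ∃ λ c′ → c ≼ c′ × Invariant c′ ×
              (∀ {v S} → v List.∈ vs → IsClique S → Target S → v ∈ S → HasFull c′ S)
    sweep [] {c} _ inv = c , (λ eq → eq) , inv , λ ()
    sweep (v ∷ vs) {c} c₀≼c inv
      with anySubset? (λ S → isClique? S ×-dec target? S ×-dec (v ∈? S) ×-dec ¬? (hasFull? c S))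
    ... | no none with c′ , c≼c′ , inv′ , fulls ← sweep vs c₀≼c inv = c′ , c≼c′ , inv′ , fulls′
      where
      fulls′ : ∀ {u S} → u List.∈ v ∷ vs → IsClique S → Target S → u ∈ S → HasFull c′ S
      fulls′ (there u∈) = fulls u∈
      fulls′ {S = S} (here refl) clS tS v∈S with hasFull? c S
      ... | yes fullS = HasFull-mono c≼c′ fullS
      ... | no ¬fullS = contradiction (S , clS , tS , v∈S , ¬fullS) none
    ... | yes (S , clS , tS , v∈S , ¬fullS)
      with c₁ , c≼c₁ , inv₁ , cS ← step c₀≼c inv clS tS ¬fullS
      with c′ , c₁≼c′ , inv′ , fulls ← sweep vs (c≼c₁ ∘ c₀≼c) inv₁
      = c′ , c₁≼c′ ∘ c≼c₁ , inv′ , fulls′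
      where
      fulls′ : ∀ {u S} → u List.∈ v ∷ vs → IsClique S → Target S → u ∈ S → HasFull c′ S
      fulls′ (there u∈)            = fulls u∈
      fulls′ (here refl) clU _ v∈U = HasFull-mono c₁≼c′ (inv₁ clU v∈U (cS v∈S))

    sweep-all : Invariant c₀ → ∃ λ c → Invariant c × (∀ {S} → IsClique S → Target S → HasFull c S)
    sweep-all inv₀ with c , _ , inv , fulls ← sweep (allFin n) (λ eq → eq) inv₀ = c , inv , fulls′
      where
      fulls′ : ∀ {S} → IsClique S → Target S → HasFull c S
      fulls′ {S} clS tS
        with v , v∈S ← clique-nonempty clS
        = fulls (∈-allFin v) clS tS v∈S

  full-colouring : ∃ λ c → ∀ {S} → IsClique S → HasFull c S
  full-colouring
    -- The empty colouring satisfies the invariant vacuously. Crossing cliques come first because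
    -- the second sweep relies on `CrossingFull`, which survives every extension.
    with c₁ , inv₁ , cf ← sweep-all crossing? {λ _ → nothing} (λ _ → crossing-step) (λ _ _ → λ { (_ , ()) })
    with c₂ , _ , fulls ← sweep-all {λ _ → Unit} (λ _ → yes tt) {c₁}
           (λ c₁≼c inv clS _ → noncrossing-step (λ cl cr → HasFull-mono c₁≼c (cf cl cr)) inv clS) inv₁
    = c₂ , λ clS → fulls clS tt

-- From full vertices to isolating colour classes.

refinement-refutes : ∀ {A : Set} {Q : A → Set} (x : Refinement A λ a → ¬ Q a) → ¬ Q (value x)
-- The stored `¬q` is irrelevant, yet may be used because the goal is empty.
refinement-refutes (_ , [ ¬q ]) q = ⊥-elim-irr (¬q q)

corollary1p10 : (k : ℕ) → k ≥ 3 → (n : ℕ) (G : Graph (Fin n)) → Regular k G →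
    ∃ λ (P : Fin (suc k) → Subset n) →
    IsPartition P × (∀ i → IsCliqueIsolating k G (P i))
corollary1p10 k k≥3 n G regular with c , fulls ← full-colouring k≥3 G regular = P , (cover , disjoint) , isolating
  where
  colour : Fin n → Fin (suc k)
  -- Vertices left uncoloured join class `zero`; this only enlarges the class, so full vertices stay
  -- dominated by it.
  colour v = fromMaybe zero (c v)

  P : Fin (suc k) → Subset n
  P i = tabulate λ v → does (colour v ≟ i)

  ∈-P⁺ : ∀ {i v} → colour v ≡ i → v ∈ P i
  ∈-P⁺ {i} = ∈-tabulate⁺ λ v → colour v ≟ i

  ∈-P⁻ : ∀ {i v} → v ∈ P i → colour v ≡ i
  ∈-P⁻ {i} = ∈-tabulate⁻ λ v → colour v ≟ i

  cover : ∀ v → ∃ λ i → v ∈ P i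
  cover v = colour v , ∈-P⁺ refl

  disjoint : ∀ {i j} → i ≢ j → ¬ Nonempty (P i ∩ P j)
  disjoint i≢j (v , v∈) = let v∈i , v∈j = x∈p∩q⁻ _ _ v∈ in i≢j (trans (sym (∈-P⁻ v∈i)) (∈-P⁻ v∈j))

  isolating : ∀ i → IsCliqueIsolating k G (P i)
  isolating i (f , f-inj , f-adj) = no-full (fulls clique)
    where
    g : Fin k → Fin n
    g j = value (f j)

    clique : IsClique k≥3 G regular (image g)
    clique = ∣image∣ g (f-inj ∘ value-injective) , adj
      where
      adj : ∀ u → u ∈ image g → ∀ v → v ∈ image g → u ≢ v → Adj G u v
      adj u u∈ v v∈ u≢v with j , refl ← ∈-image⁻ g u∈ with l , refl ← ∈-image⁻ g v∈ = f-adj (u≢v ∘ cong g)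

    no-full : ¬ HasFull k≥3 G regular c (image g)
    no-full (v , v∈ , full) with j , refl ← ∈-image⁻ g v∈ with full i
    -- The full vertex of the copy has a vertex of colour `i` in its closed neighbourhood, so it was
    -- deleted together with `N[ P i ] G`.
    ... | u , near , cu = refinement-refutes (f j) (dominated near)
      where
      u∈P : u ∈ P i
      u∈P = ∈-P⁺ (cong (fromMaybe zero) cu)
      dominated : g j ≡ u ⊎ Adj G (g j) u → N[ P i ] G (g j)
      dominated (inj₁ refl) = inj₁ u∈P
      dominated (inj₂ vu)   = inj₂ (u , u∈P , vu)
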